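{- Let $s\ge2$, let $\mathcal{P}=\prod_{i=1}^s\mathcal{E}_i$ with $|\mathcal{E}_i|=e_i>1$, let $v=|\mathcal{P}|=\prod_{i=1}^s e_i$, let $G=\mathrm{Sym}(\mathcal{E}_1)\times\cdots\times\mathrm{Sym}(\mathcal{E}_s)$ act coordinatewise on $\mathcal{P}$, and let $B\subseteq\mathcal{P}$ be nonempty with $|B|=k$. Let $D=\gcd(e_1-1,\dots,e_s-1)$, let $I=\{1,\dots,s\}$, and for each $J\subseteq I$ let $$y_J=1+\frac{k-1}{v-1}\left(\Bigl(\prod_{i\in I\setminus J}e_i\Bigr)-1\right)$$ (the empty product being $1$). If $\mathscr{D}(B,G)$ is a $2$-design on which $G$ acts flag-transitively, then: (i) $v-1$ divides $(k-1)\cdot D$, and the subset $B$ has uniform array $(y_J : J\subseteq I)$; and (ii) for each $\varnothing\ne J\subseteq I$, $y_J$ is a positive integer dividing $\frac{D_J}{D}\prod_{i\in I\setminus J}e_i$, where $D_J=\gcd(e_j-1 : j\in J)$. Moreover, for each $J\subseteq I$, each class $C\in\mathscr{C}_J$, and each block $B'$ of $\mathscr{D}(B,G)$, the intersection size $|B'\cap C|$ lies in $\{0,y_J\}$.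
   Context: All sets are finite. $G$ acts by $(\delta_1,\dots,\delta_s)^{(g_1,\dots,g_s)}=(\delta_1^{g_1},\dots,\delta_s^{g_s})$. $\mathscr{D}(B,G)$ is the incidence structure with point set $\mathcal{P}$ and block set $B^G=\{B^g : g\in G\}$; it is a $2$-design if every pair of distinct points lies in the same number of blocks. A flag is an incident point-block pair, and $G$ is flag-transitive if it is transitive on flags. For $J\subseteq I$ let $\mathcal{E}_J=\prod_{i\in J}\mathcal{E}_i$ (a singleton if $J=\varnothing$), let $\pi_J:\mathcal{P}\to\mathcal{E}_J$ be the natural projection, and for $\delta_J\in\mathcal{E}_J$ let $C_{\delta_J}=\{\varepsilon\in\mathcal{P} : \varepsilon\pi_J=\delta_J\}$; let $\mathscr{C}_J=\{C_{\delta_J} : \delta_J\in\mathcal{E}_J\}$, a partition of $\mathcal{P}$. A subset $B$ has uniform array $(y_J : J\subseteq I)$ if the $y_J$ are positive integers with $y_I=1$ and, for each $J\subsetneq I$ and each $\delta_J\in\mathcal{E}_J$, $|B\cap C_{\delta_J}|\in\{0,y_J\}$. -}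

module Defs where

open import Data.Bool using (true; false)
open import Data.Fin using (Fin; zero; suc)
open import Data.Fin.Subset using (Subset; ⊤; ∁; _∈_; _⊂_)
open import Data.Integer as ℤ using (+_; 1ℤ)
open import Data.Nat
open import Data.Nat.GCD using (gcd; gcd[m,n]≢0)
open import Data.Nat.Properties
  using (≤-refl; ≤-trans; *-mono-≤; <⇒≤; m>n⇒m∸n≢0)
open import Data.Product using (Σ; ∃; ∃-syntax; _×_; _,_; proj₁)
open import Data.Rational as ℚ using (ℚ; 1ℚ)
open import Data.Sum using (_⊎_; inj₁)
open import Data.Vec using ([]; _∷_)
open import Function using (_∘_; _↔_)
open import Function.Bundles using (Inverse)
open import Level using (Level; 0ℓ)
open import Relation.Binary using (Setoid)
open import Relation.Binary.PropositionalEquality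
  using (_≡_; refl; sym; trans; setoid)
import Relation.Binary.Construct.On as On
open import Relation.Nullary using (¬_)
open import Relation.Unary using (Pred; _≐_; _∩_)
open import Relation.Unary.Relation.Binary.Equality using (≐-setoid)

private
  variable
    a ℓ : Level
    s : ℕ

HasCard : Setoid a ℓ → ℕ → Set _
HasCard S n = Inverse S (setoid (Fin n))

∏ : Subset s → (Fin s → ℕ) → ℕ
∏ []          e = 1
∏ (true  ∷ J) e = e zero * ∏ J (e ∘ suc)
∏ (false ∷ J) e = ∏ J (e ∘ suc)

-- The greatest common divisor of the empty family is 0.
gcds : Subset s → (Fin s → ℕ) → ℕ
gcds []          e = 0
gcds (true  ∷ J) e = gcd (e zero) (gcds J (e ∘ suc))
gcds (false ∷ J) e = gcds J (e ∘ suc)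

gcd[e-1] : Subset s → (Fin s → ℕ) → ℕ
gcd[e-1] J e = gcds J (λ i → e i ∸ 1)

∏⊤>0 : (e : Fin s → ℕ) → (∀ i → 1 < e i) → 0 < ∏ ⊤ e
∏⊤>0 {zero}  e 1<e = ≤-refl
∏⊤>0 {suc s} e 1<e = *-mono-≤ (<⇒≤ (1<e zero)) (∏⊤>0 (e ∘ suc) (1<e ∘ suc))

v-1-nonZero : 2 ≤ s → (e : Fin s → ℕ) → (∀ i → 1 < e i) → NonZero (∏ ⊤ e ∸ 1)
v-1-nonZero {suc s} _ e 1<e = ≢-nonZero (m>n⇒m∸n≢0
  (*-mono-≤ (1<e zero) (∏⊤>0 (e ∘ suc) (1<e ∘ suc))))

D-nonZero : 2 ≤ s → (e : Fin s → ℕ) → (∀ i → 1 < e i) → NonZero (gcd[e-1] ⊤ e)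
D-nonZero {suc s} _ e 1<e = ≢-nonZero
  (gcd[m,n]≢0 (e zero ∸ 1) _ (inj₁ (m>n⇒m∸n≢0 (1<e zero))))

ℕ→ℚ : ℕ → ℚ
ℕ→ℚ n = + n ℚ./ 1

-- y_J = 1 + ((k − 1) / (v − 1)) · (∏_{i ∉ J} eᵢ − 1), a priori only rational.
arrayEntry : (e : Fin s → ℕ) .{{_ : NonZero (∏ ⊤ e ∸ 1)}} → ℕ → Subset s → ℚ
arrayEntry e k J =
  1ℚ ℚ.+ ((+ k ℤ.- 1ℤ) ℚ./ (∏ ⊤ e ∸ 1)) ℚ.* (ℕ→ℚ (∏ (∁ J) e) ℚ.- 1ℚ)

module _ {s : ℕ} (E : Fin s → Set) where

  Point : Set
  Point = ∀ i → E i

  -- Functions need not be extensional here, so equality of points is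
  -- coordinatewise equality.
  Points : Setoid 0ℓ 0ℓ
  Points = record
    { Carrier       = Point
    ; _≈_           = λ p q → ∀ i → p i ≡ q i
    ; isEquivalence = record
      { refl  = λ _ → refl
      ; sym   = λ p≈q i → sym (p≈q i)
      ; trans = λ p≈q q≈r i → trans (p≈q i) (q≈r i)
      }
    }

  Group : Set
  Group = ∀ i → E i ↔ E i

module _ {s : ℕ} {E : Fin s → Set} where

  open Setoid (Points E) using (_≈_)

  HasSize : Pred (Point E) 0ℓ → ℕ → Set
  HasSize P n = HasCard (On.setoid {B = Σ (Point E) P} (Points E) proj₁) n

  -- |P| ∈ {0 , y}
  SizeIn⟨0,_⟩ : ℚ → Pred (Point E) 0ℓ → Set
  SizeIn⟨0, y ⟩ P = ∃[ n ] HasSize P n × (n ≡ 0 ⊎ ℕ→ℚ n ≡ y)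

  infixl 8 _^ₚ_ _^ₛ_

  _^ₚ_ : Point E → Group E → Point E
  (δ ^ₚ g) i = Inverse.to (g i) (δ i)

  _^ₛ_ : Pred (Point E) 0ℓ → Group E → Pred (Point E) 0ℓ
  (B ^ₛ g) q = ∃[ p ] B p × (p ^ₚ g) ≈ q

  -- The incidence structure 𝒟(B,G).  A block is given by a group element
  -- g, standing for the point set B ^ₛ g; group elements with the same
  -- image of B are the same block, so blocks are counted without
  -- multiplicity.

  module _ (B : Pred (Point E) 0ℓ) where

    BlocksThrough : Point E → Point E → Setoid 0ℓ 0ℓ
    BlocksThrough p q =
      On.setoid {B = ∃[ g ] (B ^ₛ g) p × (B ^ₛ g) q}
        (≐-setoid (Point E) 0ℓ) (λ (g , _) → B ^ₛ g)

    Is2Design : Set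
    Is2Design = ∃[ λ′ ] (∀ p q → ¬ (p ≈ q) → HasCard (BlocksThrough p q) λ′)

    FlagTransitive : Set
    FlagTransitive =
      ∀ p g → (B ^ₛ g) p →
      ∀ q h → (B ^ₛ h) q →
      ∃[ x ] (p ^ₚ x) ≈ q × (B ^ₛ g ^ₛ x) ≐ (B ^ₛ h)

  E⟨_⟩ : Subset s → Set
  E⟨ J ⟩ = ∀ i → i ∈ J → E i

  Class : (J : Subset s) → E⟨ J ⟩ → Pred (Point E) 0ℓ
  Class J δ ε = ∀ i (i∈J : i ∈ J) → ε i ≡ δ i i∈J

  HasUniformArray : Pred (Point E) 0ℓ → (Subset s → ℚ) → Set
  HasUniformArray B y =
    (∀ J → ∃[ n ] 0 < n × y J ≡ ℕ→ℚ n) ×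
    y ⊤ ≡ 1ℚ ×
    (∀ J → J ⊂ ⊤ → ∀ δ → SizeIn⟨0, y J ⟩ (B ∩ Class J δ))

{-# OPTIONS --safe #-}

-- Fix α ∈ B.  By flag-transitivity every block S through a point β meets the class of β in 𝒞_J in
-- the same number y_J of points.  Let λ be the number of blocks through two points.  Counting the
-- triples (β , S , γ) with β, γ ≠ α, γ in the J-class of α and S a block through α, β, γ, once over
-- (β , S) and once over (γ , S), gives λ (v − 1) (y_J − 1) = λ (c_J − 1) (k − 1) with
-- c_J = ∏_{i∉J} eᵢ.  Cancelling λ gives the formula for y_J; if λ = 0, then k = 1 and all y_J = 1.
-- For |I ∖ J| = 1 the formula shows that v − 1 divides every (k − 1) (eᵢ − 1), hence (k − 1) D.
-- Put m = (k − 1) D / (v − 1).  Then y_J = 1 + m (c_J − 1) / D is coprime to m.  For j ∈ J the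
-- classes of 𝒞_J split those of 𝒞_{J∖j}, so y_J divides y_{J∖j} − y_J = m c_J (eⱼ − 1) / D, hence
-- c_J (eⱼ − 1) / D for all j ∈ J, and therefore c_J D_J / D.

module Submission where

open import Defs
open import Data.Bool using (true; false)
open import Data.Empty using (⊥-elim)
open import Data.Fin using (Fin; zero; suc; punchIn; punchOut; combine; remQuot)
open import Data.Fin.Permutation using (↔⇒≡)
open import Data.Fin.Properties
  using (punchOut-cong; punchIn-punchOut; punchOut-punchIn; punchInᵢ≢i; remQuot-combine;
         combine-remQuot; any?; ¬Fin0; toℕ<n)
  renaming (_≟_ to _≟ᶠ_)
open import Data.Fin.Subset using (Subset; ⊤; ⊥; ∁; ⁅_⁆; Nonempty; _∈_; _-_)
open import Data.Fin.Subset.Properties using (∉⊥; ∈⊤; p─⊥≡p; p─q⊆p; x∈p∧x≢y⇒x∈p-y)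
open import Data.Integer as ℤ using (+_; 1ℤ)
import Data.Integer.Properties as ℤ
import Data.Integer.Tactic.RingSolver as ℤ
open import Data.Nat using (ℕ; zero; suc; _+_; _*_; _∸_; _≤_; _<_; _/_; NonZero; s≤s; z≤n)
open import Data.Nat.Coprimality using (Coprime; coprime-divisor)
open import Data.Nat.Divisibility
open import Data.Nat.DivMod using (m/n*n≡m)
open import Data.Nat.GCD using (gcd-greatest; gcd[m,n]∣m; gcd[m,n]∣n; c*gcd[m,n]≡gcd[cm,cn])
open import Data.Nat.Properties
open import Data.Nat.Tactic.RingSolver using (solve-∀)
open import Data.Product using (_×_; ∃-syntax; Σ; _,_; proj₁; proj₂)
open import Data.Rational as ℚ using (ℚ; 1ℚ; toℚᵘ)
open import Data.Rational.Properties
  using (toℚᵘ-injective; toℚᵘ-homo-+; toℚᵘ-homo-*; toℚᵘ-fromℚᵘ)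
open import Data.Rational.Unnormalised as ℚᵘ using (mkℚᵘ; *≡*; _≃_)
import Data.Rational.Unnormalised.Properties as ℚᵘ
open import Data.Sum as Sum using (_⊎_; inj₁; inj₂)
open import Data.Vec using ([]; _∷_; here; there)
open import Function using (_↔_; _∘_; id; Inverse)
import Function.Construct.Composition as Composition
import Function.Construct.Symmetry as Symmetry
open import Function.Properties.Inverse using (↔-refl)
open import Level using (Level; 0ℓ; _⊔_)
open import Relation.Binary using (Setoid; _Respects_) renaming (Decidable to Decidable₂)
import Relation.Binary.Construct.On as On
open import Relation.Binary.PropositionalEquality
  using (_≡_; _≢_; refl; sym; trans; cong; cong₂; subst; setoid; module ≡-Reasoning)
open import Relation.Nullary using (¬_; Dec; yes; no)
open import Relation.Nullary.Decidable using (map′; _×-dec_)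
open import Relation.Unary using (Pred; Satisfiable; _∩_; Decidable; _≐_)
open import Relation.Unary.Properties using (≐-refl)
open import Algebra.Properties.CommutativeSemigroup *-commutativeSemigroup
  using (x∙yz≈y∙xz; xy∙z≈xz∙y)
open import Algebra.Properties.Semiring.Sum +-*-semiring
  using (sum; sum-syntax; ∑-comm; sum-cong-≗; *-distribˡ-sum; *-distribʳ-sum)

private
  variable
    a b ℓ ℓ₁ ℓ₂ p q : Level
    m n s : ℕ

-- Finite cardinalities

-- Members are compared by their underlying elements, so proofs of `P` do not affect the size. This
-- unfolds to the setoid behind `HasSize`.
Restrict : (S : Setoid a ℓ) → Pred (Setoid.Carrier S) p → Setoid (a ⊔ p) ℓ
Restrict S P = On.setoid {B = Σ (Setoid.Carrier S) P} S proj₁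

mkInverse : {S : Setoid a ℓ₁} {T : Setoid b ℓ₂} →
  let module S = Setoid S; module T = Setoid T in
  (to : S.Carrier → T.Carrier) (from : T.Carrier → S.Carrier) →
  (∀ {x y} → x S.≈ y → to x T.≈ to y) →
  (∀ {x y} → x T.≈ y → from x S.≈ from y) →
  (∀ y → to (from y) T.≈ y) → (∀ x → from (to x) S.≈ x) →
  Inverse S T
mkInverse {S = S} {T} to from to-cong from-cong to∘from from∘to = record
  { to        = to
  ; from      = from
  ; to-cong   = to-cong
  ; from-cong = from-cong
  ; inverse   = (λ y≈ → Setoid.trans T (to-cong y≈) (to∘from _))
              , (λ x≈ → Setoid.trans S (from-cong x≈) (from∘to _))
  }

Restrict-cong : {S : Setoid a ℓ₁} {T : Setoid b ℓ₂}
  {P : Pred (Setoid.Carrier S) p} {Q : Pred (Setoid.Carrier T) q}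
  (f : Inverse S T) →
  (∀ x → P x → Q (Inverse.to f x)) → (∀ y → Q y → P (Inverse.from f y)) →
  Inverse (Restrict S P) (Restrict T Q)
Restrict-cong f P⇒Q Q⇒P = mkInverse
  (λ (x , Px) → to x , P⇒Q x Px) (λ (y , Qy) → from y , Q⇒P y Qy)
  to-cong from-cong (strictlyInverseˡ ∘ proj₁) (strictlyInverseʳ ∘ proj₁)
  where open Inverse f

HasCard-cong : {S : Setoid a ℓ₁} {T : Setoid b ℓ₂} →
  Inverse S T → HasCard S n → HasCard T n
HasCard-cong f = Composition.inverse (Symmetry.inverse f)

HasCard-unique : {S : Setoid a ℓ} → HasCard S m → HasCard S n → m ≡ n
HasCard-unique i j = ↔⇒≡ (Composition.inverse (Symmetry.inverse i) j)

module _ {S : Setoid a ℓ} (card : HasCard S n) where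
  open Setoid S using (Carrier; _≈_) renaming (trans to ≈-trans; sym to ≈-sym)
  open Inverse card

  abstract
    HasCard⇒≈? : Decidable₂ _≈_
    HasCard⇒≈? x y = map′
      (λ eq → ≈-trans (≈-sym (strictlyInverseʳ x)) (inverseʳ eq))
      to-cong (to x ≟ᶠ to y)

    -- The given enumeration is reused: `punchOut` closes the gap left at the index of `x`.
    HasCard-remove : (x : Carrier) →
      ∃[ m ] n ≡ suc m × HasCard (Restrict S (λ y → ¬ x ≈ y)) m
    HasCard-remove x = helper n card
      where
      helper : ∀ n → HasCard S n →
        ∃[ m ] n ≡ suc m × HasCard (Restrict S (λ y → ¬ x ≈ y)) m
      helper zero    i with () ← Inverse.to i x
      helper (suc m) i = m , refl , mkInverse
        (λ (y , x≉y) → punchOut (≢ x≉y))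
        (λ j → I.from (punchIn (I.to x) j) ,
               λ x≈ → punchInᵢ≢i (I.to x) j (sym (trans (I.to-cong x≈) (I.strictlyInverseˡ _))))
        (λ y≈z → punchOut-cong (I.to x) (I.to-cong y≈z))
        (λ { refl → Setoid.refl S })
        (λ j → trans (punchOut-cong (I.to x) (I.strictlyInverseˡ _)) (punchOut-punchIn (I.to x)))
        (λ (y , x≉y) → I.inverseʳ (punchIn-punchOut (≢ x≉y)))
        where
        module I = Inverse i
        ≢ : ∀ {y} → ¬ x ≈ y → I.to x ≢ I.to y
        ≢ x≉y eq = x≉y (≈-trans (≈-sym (I.strictlyInverseʳ x)) (I.inverseʳ eq))

abstract
  -- The enumeration lists every member of `P`, so membership is decided by searching it. In this
  -- way the size of `B` makes `B` decidable.
  Restrict-finite⇒dec : {S : Setoid a ℓ} {P : Pred (Setoid.Carrier S) p} →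
    Decidable₂ (Setoid._≈_ S) → P Respects (Setoid._≈_ S) →
    HasCard (Restrict S P) n → Decidable P
  Restrict-finite⇒dec _≈?_ P-resp card x = map′
    (λ (j , ≈x) → P-resp ≈x (proj₂ (from j)))
    (λ Px → to (x , Px) , strictlyInverseʳ (x , Px))
    (any? (λ j → proj₁ (from j) ≈? x))
    where open Inverse card

-- Indicator function: it turns cardinalities into sums, whose order can be exchanged.
⟦_⟧ : {A : Set p} → Dec A → ℕ
⟦ yes _ ⟧ = 1
⟦ no  _ ⟧ = 0

⟦⟧-×-dec : {A : Set p} {A′ : Set q} (A? : Dec A) (A′? : Dec A′) →
  ⟦ A? ×-dec A′? ⟧ ≡ ⟦ A? ⟧ * ⟦ A′? ⟧
⟦⟧-×-dec (yes _) (yes _) = refl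
⟦⟧-×-dec (yes _) (no _)  = refl
⟦⟧-×-dec (no _)  (yes _) = refl
⟦⟧-×-dec (no _)  (no _)  = refl

HasCard-Fin : {P : Pred (Fin n) p} (P? : Decidable P) →
  HasCard (Restrict (setoid (Fin n)) P) (∑[ i < n ] ⟦ P? i ⟧)
HasCard-Fin {n = zero}  P? = mkInverse (λ ()) (λ ()) (λ { {()} }) (λ { {()} }) (λ ()) (λ ())
HasCard-Fin {n = suc n} {P = P} P? with P? zero | HasCard-Fin (P? ∘ suc)
... | yes P0 | tail = mkInverse to′ from′ to′-cong (λ { refl → refl }) to′∘from′ from′∘to′
  where
  open Inverse tail
  to′ : Σ (Fin (suc n)) P → Fin (suc (∑[ i < n ] ⟦ P? (suc i) ⟧))
  to′ (zero  , _)  = zero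
  to′ (suc i , Pi) = suc (to (i , Pi))
  from′ : Fin (suc (∑[ i < n ] ⟦ P? (suc i) ⟧)) → Σ (Fin (suc n)) P
  from′ zero    = zero , P0
  from′ (suc j) = suc (proj₁ (from j)) , proj₂ (from j)
  to′-cong : ∀ {x y} → proj₁ x ≡ proj₁ y → to′ x ≡ to′ y
  to′-cong {zero  , _} refl = refl
  to′-cong {suc i , _} refl = cong suc (to-cong refl)
  to′∘from′ : ∀ j → to′ (from′ j) ≡ j
  to′∘from′ zero    = refl
  to′∘from′ (suc j) = cong suc (strictlyInverseˡ j)
  from′∘to′ : ∀ x → proj₁ (from′ (to′ x)) ≡ proj₁ x
  from′∘to′ (zero  , _)  = refl
  from′∘to′ (suc i , Pi) = cong suc (strictlyInverseʳ (i , Pi))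
... | no ¬P0 | tail = HasCard-cong
  (mkInverse (λ (i , Pi) → suc i , Pi) from′ (cong suc) from′-cong
    (λ { (zero , P0) → ⊥-elim (¬P0 P0) ; (suc _ , _) → refl }) (λ _ → refl)) tail
  where
  from′ : Σ (Fin (suc n)) P → Σ (Fin n) (P ∘ suc)
  from′ (zero  , P0) = ⊥-elim (¬P0 P0)
  from′ (suc i , Pi) = i , Pi
  from′-cong : ∀ {x y} → proj₁ x ≡ proj₁ y → proj₁ (from′ x) ≡ proj₁ (from′ y)
  from′-cong {zero  , P0} refl = ⊥-elim (¬P0 P0)
  from′-cong {suc i , _}  refl = refl

module _ {S : Setoid a ℓ} (card : HasCard S n)
  {P : Pred (Setoid.Carrier S) p} (P? : Decidable P) where
  open Inverse card

  count : ℕ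
  count = ∑[ i < n ] ⟦ P? (from i) ⟧

  HasCard-Restrict : P Respects (Setoid._≈_ S) → HasCard (Restrict S P) count
  HasCard-Restrict P-resp = HasCard-cong
    (Restrict-cong (Symmetry.inverse card) (λ _ → id)
      (λ x → P-resp (Setoid.sym S (strictlyInverseʳ x))))
    (HasCard-Fin (P? ∘ from))

  count≡suc⇒∃ : ∀ {m} → count ≡ suc m → ∃[ x ] P x
  count≡suc⇒∃ eq with any? (P? ∘ from)
  ... | yes (i , Pi) = from i , Pi
  ... | no  ∄ = ⊥-elim (0≢1+n (trans (sym (sum-zero (P? ∘ from) (λ i Pi → ∄ (i , Pi)))) eq))
    where
    sum-zero : ∀ {n} {P : Pred (Fin n) p} (P? : Decidable P) → (∀ i → ¬ P i) →
      ∑[ i < n ] ⟦ P? i ⟧ ≡ 0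
    sum-zero {zero}  P? ¬P = refl
    sum-zero {suc n} P? ¬P with P? zero
    ... | yes P0 = ⊥-elim (¬P zero P0)
    ... | no _   = sum-zero (P? ∘ suc) (¬P ∘ suc)

-- Sums over `Fin` and double counting

sum-const : ∀ n {f : Fin n → ℕ} {c} → (∀ i → f i ≡ c) → ∑[ i < n ] f i ≡ n * c
sum-const zero    f≗c = refl
sum-const (suc n) f≗c = cong₂ _+_ (f≗c zero) (sum-const n (f≗c ∘ suc))

∣-sum : ∀ {d} (f : Fin n → ℕ) → (∀ i → d ∣ f i) → d ∣ ∑[ i < n ] f i
∣-sum {zero}  f d∣f = _ ∣0
∣-sum {suc n} f d∣f = ∣m∣n⇒∣m+n (d∣f zero) (∣-sum (f ∘ suc) (d∣f ∘ suc))

-- Both sides count the triples (β , j , γ) with γ on the j-th block through β.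
double-count : ∀ {w l} (N : Fin w → Fin l → Fin w → ℕ) →
  (∀ β γ → ∑[ j < l ] N β j γ ≡ ∑[ j < l ] N γ j β) →
  (f g : Fin w → ℕ) (x y : ℕ) →
  (∀ β j → ∑[ γ < w ] (f γ * N β j γ) ≡ x) →
  (∀ β j → ∑[ γ < w ] (g γ * N β j γ) ≡ y) →
  sum g * (l * x) ≡ sum f * (l * y)
double-count {w} {l} N N-sym f g x y f-sum g-sum = begin
  sum g * (l * x)                                     ≡⟨ weigh g f x f-sum ⟩
  ∑[ β < w ] ∑[ γ < w ] (g β * (f γ * M β γ))         ≡⟨ ∑-comm (λ β γ → g β * (f γ * M β γ)) ⟩
  ∑[ γ < w ] ∑[ β < w ] (g β * (f γ * M β γ))
    ≡⟨ sum-cong-≗ (λ γ → sum-cong-≗ (λ β → trans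
         (cong (λ z → g β * (f γ * z)) (N-sym β γ)) (x∙yz≈y∙xz (g β) (f γ) (M γ β)))) ⟩
  ∑[ γ < w ] ∑[ β < w ] (f γ * (g β * M γ β))         ≡⟨ weigh f g y g-sum ⟨
  sum f * (l * y)                                     ∎
  where
  open ≡-Reasoning
  M : Fin w → Fin w → ℕ
  M β γ = ∑[ j < l ] N β j γ
  -- Exchanging the sums makes `N` occur only through `M`, whose symmetry `N-sym` then links the two
  -- sides.
  weigh : (g f : Fin w → ℕ) (x : ℕ) → (∀ β j → ∑[ γ < w ] (f γ * N β j γ) ≡ x) →
    sum g * (l * x) ≡ ∑[ β < w ] ∑[ γ < w ] (g β * (f γ * M β γ))
  weigh g f x f-sum = trans (*-distribʳ-sum (l * x) g) (sum-cong-≗ λ β → begin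
    g β * (l * x)                                     ≡⟨ cong (g β *_) (sum-const l (f-sum β)) ⟨
    g β * ∑[ j < l ] ∑[ γ < w ] (f γ * N β j γ)
      ≡⟨ cong (g β *_) (∑-comm (λ j γ → f γ * N β j γ)) ⟩
    g β * ∑[ γ < w ] ∑[ j < l ] (f γ * N β j γ)
      ≡⟨ cong (g β *_) (sum-cong-≗ λ γ → *-distribˡ-sum (f γ) (λ j → N β j γ)) ⟨
    g β * ∑[ γ < w ] (f γ * M β γ)                    ≡⟨ *-distribˡ-sum (g β) (λ γ → f γ * M β γ) ⟩
    ∑[ γ < w ] (g β * (f γ * M β γ))                  ∎)

⟦≟⟧-sum : (a : Fin n) → ∑[ b < n ] ⟦ a ≟ᶠ b ⟧ ≡ 1
⟦≟⟧-sum {n} a = HasCard-unique (HasCard-Fin (a ≟ᶠ_)) (mkInverse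
  (λ _ → zero {0}) (λ _ → a , refl) (λ _ → refl) (λ _ → refl)
  (λ { zero → refl }) proj₂)

module _ {S : Setoid a ℓ} (card : HasCard S n)
  {P : Pred (Setoid.Carrier S) p} (P? : Decidable P) where
  open Inverse card

  -- Each element lies in exactly one fibre of `f`, so the fibre counts add up to the total.
  ∣-count-fibres : ∀ {m d} (f : Setoid.Carrier S → Fin m) →
    (∀ b → d ∣ count card (λ x → P? x ×-dec (f x ≟ᶠ b))) → d ∣ count card P?
  ∣-count-fibres {m} {d} f d∣ = subst (d ∣_) fibres (∣-sum _ d∣)
    where
    open ≡-Reasoning
    fibres : ∑[ b < m ] count card (λ x → P? x ×-dec (f x ≟ᶠ b)) ≡ count card P?
    fibres = begin
      ∑[ b < m ] ∑[ i < n ] ⟦ P? (from i) ×-dec (f (from i) ≟ᶠ b) ⟧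
        ≡⟨ ∑-comm (λ b i → ⟦ P? (from i) ×-dec (f (from i) ≟ᶠ b) ⟧) ⟩
      ∑[ i < n ] ∑[ b < m ] ⟦ P? (from i) ×-dec (f (from i) ≟ᶠ b) ⟧
        ≡⟨ sum-cong-≗ (λ i → begin
             ∑[ b < m ] ⟦ P? (from i) ×-dec (f (from i) ≟ᶠ b) ⟧
               ≡⟨ sum-cong-≗ (λ b → ⟦⟧-×-dec (P? (from i)) (f (from i) ≟ᶠ b)) ⟩
             ∑[ b < m ] (⟦ P? (from i) ⟧ * ⟦ f (from i) ≟ᶠ b ⟧)
               ≡⟨ *-distribˡ-sum ⟦ P? (from i) ⟧ (λ b → ⟦ f (from i) ≟ᶠ b ⟧) ⟨
             ⟦ P? (from i) ⟧ * ∑[ b < m ] ⟦ f (from i) ≟ᶠ b ⟧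
               ≡⟨ cong (⟦ P? (from i) ⟧ *_) (⟦≟⟧-sum (f (from i))) ⟩
             ⟦ P? (from i) ⟧ * 1
               ≡⟨ *-identityʳ _ ⟩
             ⟦ P? (from i) ⟧ ∎) ⟩
      count card P? ∎

  -- `P` is `x` together with its members other than `x`. This converts counts that omit a base
  -- point into full sizes.
  HasCard-Restrict-remove : P Respects (Setoid._≈_ S) →
    ∀ x → P x → ∀ {m c} (card′ : HasCard (Restrict S (λ y → ¬ Setoid._≈_ S x y)) m) →
    HasCard (Restrict S P) c → c ≡ suc (count card′ (P? ∘ proj₁))
  HasCard-Restrict-remove P-resp x Px card′ cardP
    with m , c≡ , card-remove ← HasCard-remove cardP (x , Px)
    = trans c≡ (cong suc (HasCard-unique card-remove (HasCard-cong
        (mkInverse (λ ((y , x≉y) , Py) → (y , Py) , x≉y) (λ ((y , Py) , x≉y) → (y , x≉y) , Py)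
          id id (λ _ → Setoid.refl S) (λ _ → Setoid.refl S))
        (HasCard-Restrict card′ (P? ∘ proj₁) P-resp))))

-- Sizes of classes

abstract
  -- Induction on `J`: a coordinate in `J` is prescribed and contributes no factor; one outside is
  -- free and contributes its `e` through `combine`.
  HasSize-Class : {s : ℕ} {E : Fin s → Set} {e : Fin s → ℕ} → (∀ i → E i ↔ Fin (e i)) →
    (J : Subset s) (δ : E⟨_⟩ {E = E} J) → HasSize (Class {E = E} J δ) (∏ (∁ J) e)
  HasSize-Class enum [] δ = mkInverse (λ _ → zero) (λ _ → (λ ()) , λ ())
    (λ _ → refl) (λ _ ()) (λ { zero → refl }) (λ _ ())
  HasSize-Class {E = E} enum (true ∷ J) δ = HasCard-cong
    (mkInverse
      (λ (ε , ε∈) → cons ε , λ { zero here → refl ; (suc i) (there i∈J) → ε∈ i i∈J })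
      (λ (ε , ε∈) → ε ∘ suc , λ i → ε∈ (suc i) ∘ there)
      (λ { ε≈ zero → refl ; ε≈ (suc i) → ε≈ i })
      (λ ε≈ → ε≈ ∘ suc)
      (λ { (ε , ε∈) zero → sym (ε∈ zero here) ; _ (suc i) → refl })
      (λ _ _ → refl))
    (HasSize-Class (enum ∘ suc) J (λ i → δ (suc i) ∘ there))
    where
    cons : Point (E ∘ suc) → Point E
    cons ε zero    = δ zero here
    cons ε (suc i) = ε i
  HasSize-Class {E = E} {e} enum (false ∷ J) δ = mkInverse
    (λ (ε , ε∈) → combine (E₀.to (ε zero)) (to (tail ε ε∈)))
    (λ j → let (j₀ , j₁) = remQuot {e zero} (∏ (∁ J) (e ∘ suc)) j in
      cons (E₀.from j₀) (proj₁ (from j₁)) ,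
      λ { (suc i) (there i∈J) → proj₂ (from j₁) i i∈J })
    (λ ε≈ → cong₂ combine (cong E₀.to (ε≈ zero)) (to-cong (ε≈ ∘ suc)))
    (λ { refl _ → refl })
    (λ j → let (j₀ , j₁) = remQuot {e zero} (∏ (∁ J) (e ∘ suc)) j in
      trans (cong₂ combine (E₀.strictlyInverseˡ j₀) (strictlyInverseˡ j₁))
        (combine-remQuot {e zero} (∏ (∁ J) (e ∘ suc)) j))
    (λ { (ε , ε∈) zero → trans (cong (E₀.from ∘ proj₁) (remQuot-combine (E₀.to (ε zero)) _))
           (E₀.strictlyInverseʳ (ε zero))
       ; (ε , ε∈) (suc i) → trans
           (cong (λ jj → proj₁ (from (proj₂ jj)) i) (remQuot-combine (E₀.to (ε zero)) _))
           (strictlyInverseʳ (tail ε ε∈) i) })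
    where
    module E₀ = Inverse (enum zero)
    δ′ : E⟨_⟩ {E = E ∘ suc} J
    δ′ i = δ (suc i) ∘ there
    open Inverse (HasSize-Class (enum ∘ suc) J δ′)
    tail : (ε : Point E) → Class (false ∷ J) δ ε → Σ (Point (E ∘ suc)) (Class J δ′)
    tail ε ε∈ = ε ∘ suc , λ i → ε∈ (suc i) ∘ there
    cons : E zero → Point (E ∘ suc) → Point E
    cons x ε zero    = x
    cons x ε (suc i) = ε i

∁⊥≡⊤ : ∁ (⊥ {s}) ≡ ⊤
∁⊥≡⊤ {zero}  = refl
∁⊥≡⊤ {suc s} = cong (true ∷_) ∁⊥≡⊤

∏-∁⊤ : (e : Fin s → ℕ) → ∏ (∁ ⊤) e ≡ 1
∏-∁⊤ {zero}  e = refl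
∏-∁⊤ {suc s} e = ∏-∁⊤ (e ∘ suc)

abstract
  -- The whole point set is the only class for `J = ⊥`, as no coordinate is prescribed.
  HasCard-Points : {E : Fin s → Set} {e : Fin s → ℕ} → (∀ i → E i ↔ Fin (e i)) →
    HasCard (Points E) (∏ ⊤ e)
  HasCard-Points {E = E} {e} enum = subst (λ J → HasCard (Points E) (∏ J e)) ∁⊥≡⊤ (HasCard-cong
    (mkInverse proj₁ (λ ε → ε , λ i i∈⊥ → ⊥-elim (∉⊥ i∈⊥)) id id (λ _ _ → refl) (λ _ _ → refl))
    (HasSize-Class enum ⊥ (λ i i∈⊥ → ⊥-elim (∉⊥ i∈⊥))))

∏-∁-remove : (J : Subset s) (e : Fin s → ℕ) → ∀ {j} → j ∈ J →
  ∏ (∁ (J - j)) e ≡ e j * ∏ (∁ J) e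
∏-∁-remove (true  ∷ J) e here        = cong (λ J′ → e zero * ∏ (∁ J′) (e ∘ suc)) (p─⊥≡p J)
∏-∁-remove (true  ∷ J) e (there j∈J) = ∏-∁-remove J (e ∘ suc) j∈J
∏-∁-remove (false ∷ J) e {suc j} (there j∈J) = trans
  (cong (e zero *_) (∏-∁-remove J (e ∘ suc) j∈J)) (x∙yz≈y∙xz (e zero) (e (suc j)) _)

-- Arithmetic of the array entries

*-cancelˡ-common : ∀ l a b c d → a * (suc l * b) ≡ c * (suc l * d) → a * b ≡ c * d
*-cancelˡ-common l a b c d eq = *-cancelˡ-≡ (a * b) (c * d) (suc l)
  (trans (x∙yz≈y∙xz (suc l) a b) (trans eq (x∙yz≈y∙xz c (suc l) d)))

gcds-∣ : (J : Subset s) (f : Fin s → ℕ) → ∀ {i} → i ∈ J → gcds J f ∣ f i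
gcds-∣ (true  ∷ J) f here        = gcd[m,n]∣m (f zero) _
gcds-∣ (true  ∷ J) f (there i∈J) = ∣-trans (gcd[m,n]∣n (f zero) _) (gcds-∣ J (f ∘ suc) i∈J)
gcds-∣ (false ∷ J) f (there i∈J) = gcds-∣ J (f ∘ suc) i∈J

-- Multiplication by `c` distributes over `gcd`, so the hypotheses merge one index at a time. The
-- empty family has gcd 0, which every `d` divides.
∣*-gcds : (J : Subset s) (f : Fin s → ℕ) (c : ℕ) {d : ℕ} →
  (∀ i → i ∈ J → d ∣ c * f i) → d ∣ c * gcds J f
∣*-gcds []          f c {d} d∣ = subst (d ∣_) (sym (*-zeroʳ c)) (d ∣0)
∣*-gcds (true  ∷ J) f c {d} d∣ = subst (d ∣_) (sym (c*gcd[m,n]≡gcd[cm,cn] c (f zero) _))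
  (gcd-greatest (d∣ zero here) (∣*-gcds J (f ∘ suc) c (λ i → d∣ (suc i) ∘ there)))
∣*-gcds (false ∷ J) f c d∣ = ∣*-gcds J (f ∘ suc) c (λ i → d∣ (suc i) ∘ there)

∏>0 : (J : Subset s) (e : Fin s → ℕ) → (∀ i → 1 < e i) → 0 < ∏ J e
∏>0 []          e 1<e = s≤s z≤n
∏>0 (true  ∷ J) e 1<e = *-mono-≤ (<⇒≤ (1<e zero)) (∏>0 J (e ∘ suc) (1<e ∘ suc))
∏>0 (false ∷ J) e 1<e = ∏>0 J (e ∘ suc) (1<e ∘ suc)

-- (1 + x)(1 + y) - 1 = y + x(1 + y), so being 1 modulo `d` is preserved under products.
∣∏∸1 : (J : Subset s) (e : Fin s → ℕ) → (∀ i → 1 < e i) → ∀ {d} →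
  (∀ i → d ∣ e i ∸ 1) → d ∣ ∏ J e ∸ 1
∣∏∸1 []          e 1<e d∣ = _ ∣0
∣∏∸1 (true  ∷ J) e 1<e {d} d∣
  with e zero | <⇒≤ (1<e zero) | d∣ zero
     | ∏ J (e ∘ suc) | ∏>0 J (e ∘ suc) (1<e ∘ suc) | ∣∏∸1 J (e ∘ suc) (1<e ∘ suc) (d∣ ∘ suc)
... | suc x | _ | d∣x | suc y | _ | d∣y = ∣m∣n⇒∣m+n d∣y (∣m⇒∣m*n (suc y) d∣x)
∣∏∸1 (false ∷ J) e 1<e d∣ = ∣∏∸1 J (e ∘ suc) (1<e ∘ suc) (d∣ ∘ suc)

-- Passage to rational entries

pos-*-cong : ∀ m n o p → m * n ≡ o * p → + m ℤ.* + n ≡ + o ℤ.* + p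
pos-*-cong m n o p eq = trans (sym (ℤ.pos-* m n)) (trans (cong +_ eq) (ℤ.pos-* o p))

toℚᵘ-/ : ∀ p d → toℚᵘ (p ℚ./ suc d) ≃ mkℚᵘ p d
toℚᵘ-/ p d = toℚᵘ-fromℚᵘ (mkℚᵘ p d)

-- In unnormalised rationals the claim reduces to the cross-multiplied equation in the hypothesis.
-- Positivity of `k` and `c` makes truncated subtraction agree with that of integers.
[k-1]/w*[c-1]+1≡1+x : ∀ {x k c w} .{{_ : NonZero w}} → 0 < k → 0 < c →
  x * w ≡ (c ∸ 1) * (k ∸ 1) →
  1ℚ ℚ.+ ((+ k ℤ.- 1ℤ) ℚ./ w) ℚ.* (ℕ→ℚ c ℚ.- 1ℚ) ≡ ℕ→ℚ (suc x)
[k-1]/w*[c-1]+1≡1+x {x} {suc k} {suc c} {w@(suc w-1)} _ _ xw≡ck = toℚᵘ-injective (begin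
  toℚᵘ (1ℚ ℚ.+ r ℚ.* (ℕ→ℚ (suc c) ℚ.- 1ℚ))
    ≈⟨ toℚᵘ-homo-+ 1ℚ (r ℚ.* (ℕ→ℚ (suc c) ℚ.- 1ℚ)) ⟩
  toℚᵘ 1ℚ ℚᵘ.+ toℚᵘ (r ℚ.* (ℕ→ℚ (suc c) ℚ.- 1ℚ))
    ≈⟨ ℚᵘ.+-congʳ (toℚᵘ 1ℚ) (toℚᵘ-homo-* r (ℕ→ℚ (suc c) ℚ.- 1ℚ)) ⟩
  toℚᵘ 1ℚ ℚᵘ.+ toℚᵘ r ℚᵘ.* toℚᵘ (ℕ→ℚ (suc c) ℚ.- 1ℚ)
    ≈⟨ ℚᵘ.+-congʳ (toℚᵘ 1ℚ) (ℚᵘ.*-cong (toℚᵘ-/ (+ k) w-1) c-1) ⟩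
  toℚᵘ 1ℚ ℚᵘ.+ mkℚᵘ (+ k) w-1 ℚᵘ.* mkℚᵘ (+ c) 0
    ≈⟨ ℚᵘ.+-congʳ (toℚᵘ 1ℚ) kc/w ⟩
  mkℚᵘ (+ 1) 0 ℚᵘ.+ mkℚᵘ (+ x) 0
    ≈⟨ *≡* (+-unit (+ x)) ⟩
  mkℚᵘ (+ suc x) 0
    ≈⟨ toℚᵘ-/ (+ suc x) 0 ⟨
  toℚᵘ (ℕ→ℚ (suc x)) ∎)
  where
  open ℚᵘ.≃-Reasoning
  r : ℚ
  r = (+ k) ℚ./ w
  +-unit : ∀ x → (1ℤ ℤ.* 1ℤ ℤ.+ x ℤ.* 1ℤ) ℤ.* 1ℤ ≡ (1ℤ ℤ.+ x) ℤ.* (1ℤ ℤ.* 1ℤ)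
  +-unit = ℤ.solve-∀
  ∸-unit : ∀ c → ((1ℤ ℤ.+ c) ℤ.* 1ℤ ℤ.+ (ℤ.- 1ℤ) ℤ.* 1ℤ) ℤ.* 1ℤ ≡ c ℤ.* (1ℤ ℤ.* 1ℤ)
  ∸-unit = ℤ.solve-∀
  c-1 : toℚᵘ (ℕ→ℚ (suc c) ℚ.- 1ℚ) ≃ mkℚᵘ (+ c) 0
  c-1 = begin
    toℚᵘ (ℕ→ℚ (suc c) ℚ.- 1ℚ)                 ≈⟨ toℚᵘ-homo-+ (ℕ→ℚ (suc c)) (ℚ.- 1ℚ) ⟩
    toℚᵘ (ℕ→ℚ (suc c)) ℚᵘ.+ toℚᵘ (ℚ.- 1ℚ)
      ≈⟨ ℚᵘ.+-congˡ (toℚᵘ (ℚ.- 1ℚ)) (toℚᵘ-/ (+ suc c) 0) ⟩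
    mkℚᵘ (+ suc c) 0 ℚᵘ.+ mkℚᵘ (ℤ.- 1ℤ) 0      ≈⟨ *≡* (∸-unit (+ c)) ⟩
    mkℚᵘ (+ c) 0                               ∎
  kc/w : mkℚᵘ (+ k) w-1 ℚᵘ.* mkℚᵘ (+ c) 0 ≃ mkℚᵘ (+ x) 0
  kc/w = *≡* (trans (ℤ.*-identityʳ (+ k ℤ.* + c))
    (trans (pos-*-cong k c x w (trans (*-comm k c) (sym xw≡ck)))
      (cong (λ d → + x ℤ.* + d) (sym (*-identityʳ w)))))

module _ {w D K m : ℕ} .{{_ : NonZero w}} .{{_ : NonZero D}} (KD≡mw : K * D ≡ m * w) where

  -- Intended reading: `w` = v - 1, `K` = k - 1, `m` = (k - 1) D / (v - 1). Both sides are compared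
  -- after multiplication by D w, which avoids division.
  scale-solution : ∀ {x c t} → x * w ≡ c * K → c ≡ t * D → x ≡ t * m
  scale-solution {x} {_} {t} xw≡cK refl = *-cancelʳ-≡ x (t * m) D (*-cancelʳ-≡ _ _ w (begin
    x * D * w       ≡⟨ xy∙z≈xz∙y x D w ⟩
    x * w * D       ≡⟨ cong (_* D) xw≡cK ⟩
    t * D * K * D   ≡⟨ *-assoc (t * D) K D ⟩
    t * D * (K * D) ≡⟨ cong (t * D *_) KD≡mw ⟩
    t * D * (m * w) ≡⟨ regroup t D m w ⟩
    t * m * D * w   ∎))
    where
    open ≡-Reasoning
    regroup : ∀ t D m w → t * D * (m * w) ≡ t * m * D * w
    regroup = solve-∀

  -- Here suc x and suc z are the entries y_J and y_{J∖j}, with c = ∏_{i∉J} eᵢ and f = eⱼ.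
  -- Since y_J = 1 + m ((c − 1) / D), it is coprime to m.
  entry∣⇒entry*D∣ : ∀ {x z c f} → 0 < c → 0 < f → D ∣ c ∸ 1 → D ∣ f ∸ 1 →
    x * w ≡ (c ∸ 1) * K → z * w ≡ (f * c ∸ 1) * K →
    suc x ∣ suc z → suc x * D ∣ c * (f ∸ 1)
  entry∣⇒entry*D∣ {x} {z} {suc c} {suc f} _ _ (divides t c≡) (divides u f≡) xw≡ zw≡ x∣z =
    subst (suc x * D ∣_) (trans (*-assoc (suc c) u D) (cong (suc c *_) (sym f≡)))
      (*-monoˡ-∣ D (coprime-divisor coprime x∣mcu))
    where
    open ≡-Reasoning
    x≡ : x ≡ t * m
    x≡ = scale-solution {t = t} xw≡ c≡
    coprime : Coprime (suc x) m
    coprime {d} (d∣1+x , d∣m) = ∣1⇒≡1 (∣m+n∣m⇒∣n (subst (d ∣_) (+-comm 1 x) d∣1+x)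
      (subst (d ∣_) (sym x≡) (∣n⇒∣m*n t d∣m)))
    -- Let c and f be the full factors, t = (c - 1) / D and u = (f - 1) / D. Then f c - 1 = (t + u
    -- c) D, so the two entries differ by m c u. `suc x` divides this difference, and `m` drops out
    -- by coprimality.
    z≡ : suc z ≡ suc x + m * (suc c * u)
    z≡ = begin
      suc z                       ≡⟨ cong suc (scale-solution {t = t + u * suc c} zw≡ (begin
        c + f * suc c               ≡⟨ cong₂ (λ a b → a + b * suc c) c≡ f≡ ⟩
        t * D + u * D * suc c       ≡⟨ collect t D u (suc c) ⟩
        (t + u * suc c) * D         ∎)) ⟩
      suc ((t + u * suc c) * m)   ≡⟨ expand t u (suc c) m ⟩
      suc (t * m) + m * (suc c * u) ≡⟨ cong (λ y → suc y + m * (suc c * u)) x≡ ⟨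
      suc x + m * (suc c * u)     ∎
      where
      collect : ∀ t D u c → t * D + u * D * c ≡ (t + u * c) * D
      collect = solve-∀
      expand : ∀ t u c m → 1 + (t + u * c) * m ≡ 1 + t * m + m * (c * u)
      expand = solve-∀
    x∣mcu : suc x ∣ m * (suc c * u)
    x∣mcu = ∣m+n∣m⇒∣n (subst (suc x ∣_) z≡ x∣z) ∣-refl

-- Two facts are taken from the design: the counting equation for `y-1`, and the divisibility
-- between entries when an index leaves `J`. The rest is arithmetic.
module ArrayArithmetic {s : ℕ} {e : Fin s → ℕ} (1<e : ∀ i → 1 < e i) {k : ℕ} (0<k : 0 < k)
  .{{_ : NonZero (∏ ⊤ e ∸ 1)}} .{{_ : NonZero (gcd[e-1] ⊤ e)}}
  (y-1 : Subset s → ℕ)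
  (y-1-equation : ∀ J → y-1 J * (∏ ⊤ e ∸ 1) ≡ (∏ (∁ J) e ∸ 1) * (k ∸ 1))
  (y∣y-remove : ∀ J {j} → j ∈ J → suc (y-1 J) ∣ suc (y-1 (J - j)))
  where

  private
    D : ℕ
    D = gcd[e-1] ⊤ e
    e-1 : Fin s → ℕ
    e-1 i = e i ∸ 1

  arrayEntry≡1+y-1 : ∀ J → arrayEntry e k J ≡ ℕ→ℚ (suc (y-1 J))
  arrayEntry≡1+y-1 J = [k-1]/w*[c-1]+1≡1+x {y-1 J} 0<k (∏>0 (∁ J) e 1<e) (y-1-equation J)

  arrayEntry-⊤ : arrayEntry e k ⊤ ≡ 1ℚ
  arrayEntry-⊤ = trans (arrayEntry≡1+y-1 ⊤) (cong (ℕ→ℚ ∘ suc) (m*n≡0⇒m≡0 (y-1 ⊤) (∏ ⊤ e ∸ 1)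
    (trans (y-1-equation ⊤) (cong (λ c → (c ∸ 1) * (k ∸ 1)) (∏-∁⊤ e)))))

  remove-equation : ∀ J {j} → j ∈ J →
    y-1 (J - j) * (∏ ⊤ e ∸ 1) ≡ (e j * ∏ (∁ J) e ∸ 1) * (k ∸ 1)
  remove-equation J {j} j∈J = trans (y-1-equation (J - j))
    (cong (λ c → (c ∸ 1) * (k ∸ 1)) (∏-∁-remove J e j∈J))

  v-1∣[k-1]D : ∏ ⊤ e ∸ 1 ∣ (k ∸ 1) * D
  -- Classes for `⊤ - i` have `e i` points, so `y-1 (⊤ - i)` is the quotient of (k - 1)(e i - 1) by
  -- v - 1.
  v-1∣[k-1]D = ∣*-gcds ⊤ e-1 (k ∸ 1) λ i i∈⊤ → divides (y-1 (⊤ - i)) (begin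
    (k ∸ 1) * (e i ∸ 1)                  ≡⟨ *-comm (k ∸ 1) (e i ∸ 1) ⟩
    (e i ∸ 1) * (k ∸ 1)                  ≡⟨ cong (λ c → (c ∸ 1) * (k ∸ 1)) (*-identityʳ (e i)) ⟨
    (e i * 1 ∸ 1) * (k ∸ 1)              ≡⟨ cong (λ c → (e i * c ∸ 1) * (k ∸ 1)) (∏-∁⊤ e) ⟨
    (e i * ∏ (∁ ⊤) e ∸ 1) * (k ∸ 1)      ≡⟨ remove-equation ⊤ i∈⊤ ⟨
    y-1 (⊤ - i) * (∏ ⊤ e ∸ 1)            ∎)
    where open ≡-Reasoning

  D∣e-1 : ∀ i → D ∣ e i ∸ 1
  D∣e-1 i = gcds-∣ ⊤ e-1 ∈⊤

  y*D∣∏*[e-1] : ∀ J j → j ∈ J → suc (y-1 J) * D ∣ ∏ (∁ J) e * (e j ∸ 1)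
  y*D∣∏*[e-1] J j j∈J = entry∣⇒entry*D∣ {m = quotient v-1∣[k-1]D} (_∣_.equality v-1∣[k-1]D)
    (∏>0 (∁ J) e 1<e) (<⇒≤ (1<e j)) (∣∏∸1 (∁ J) e 1<e D∣e-1) (D∣e-1 j)
    (y-1-equation J) (remove-equation J j∈J) (y∣y-remove J j∈J)

  -- The divisibilities for single `j` merge into one for D_J; the factor D carried along is
  -- cancelled at the end. As D divides D_J, the truncated quotient is exact.
  y∣D_J/D*∏ : ∀ J → suc (y-1 J) ∣ (gcd[e-1] J e / D) * ∏ (∁ J) e
  y∣D_J/D*∏ J = *-cancelʳ-∣ D (subst (suc (y-1 J) * D ∣_) (begin
    ∏ (∁ J) e * gcd[e-1] J e             ≡⟨ *-comm (∏ (∁ J) e) _ ⟩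
    gcd[e-1] J e * ∏ (∁ J) e             ≡⟨ cong (_* ∏ (∁ J) e) (m/n*n≡m D∣D_J) ⟨
    gcd[e-1] J e / D * D * ∏ (∁ J) e     ≡⟨ xy∙z≈xz∙y (gcd[e-1] J e / D) D _ ⟩
    gcd[e-1] J e / D * ∏ (∁ J) e * D     ∎)
    (∣*-gcds J e-1 (∏ (∁ J) e) (y*D∣∏*[e-1] J)))
    where
    open ≡-Reasoning
    D∣D_J : D ∣ gcd[e-1] J e
    D∣D_J = subst (D ∣_) (*-identityˡ _)
      (∣*-gcds J e-1 1 λ i _ → subst (D ∣_) (sym (*-identityˡ (e-1 i))) (D∣e-1 i))

-- Counting in a flag-transitive design

C⟨_⟩ : {s : ℕ} {E : Fin s → Set} (J : Subset s) → Point E → Pred (Point E) 0ℓ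
C⟨_⟩ {E = E} J β = Class {E = E} J (λ i _ → β i)

HasSize-≐ : {s n : ℕ} {E : Fin s → Set} {P Q : Pred (Point E) 0ℓ} →
  P ≐ Q → HasSize P n → HasSize Q n
HasSize-≐ (P⊆Q , Q⊆P) = HasCard-cong
  (mkInverse (λ (x , Px) → x , P⊆Q Px) (λ (x , Qx) → x , Q⊆P Qx)
    id id (λ _ _ → refl) (λ _ _ → refl))

module _ {s : ℕ} {E : Fin s → Set} where

  action : Group E → Inverse (Points E) (Points E)
  action g = mkInverse (_^ₚ g) (λ p i → Inverse.from (g i) (p i))
    (λ p≈q i → cong (Inverse.to (g i)) (p≈q i)) (λ p≈q i → cong (Inverse.from (g i)) (p≈q i))
    (λ p i → Inverse.strictlyInverseˡ (g i) (p i)) (λ p i → Inverse.strictlyInverseʳ (g i) (p i))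

  -- Both sides are the blocks through `p`, `q` and `r`. This is the source of the symmetry in the
  -- double count.
  BlocksThrough-swap : (B : Pred (Point E) 0ℓ) (p q r : Point E) →
    Inverse (Restrict (BlocksThrough B p q) (λ (g , _) → (B ^ₛ g) r))
            (Restrict (BlocksThrough B p r) (λ (g , _) → (B ^ₛ g) q))
  BlocksThrough-swap B p q r = mkInverse
    (λ ((g , p∈ , q∈) , r∈) → (g , p∈ , r∈) , q∈)
    (λ ((g , p∈ , r∈) , q∈) → (g , p∈ , q∈) , r∈)
    id id (λ _ → ≐-refl) (λ _ → ≐-refl)

  ε : Group E
  ε i = ↔-refl

module FlagTransitiveDesign
  {s : ℕ} {E : Fin s → Set} {e : Fin s → ℕ} (enum : ∀ i → E i ↔ Fin (e i))
  {B : Pred (Point E) 0ℓ} (B-resp : B Respects Setoid._≈_ (Points E))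
  {k : ℕ} (∣B∣≡k : HasSize B k) {α : Point E} (α∈B : B α)
  (design : Is2Design B) (flag-transitive : FlagTransitive B)
  where

  open Setoid (Points E) using (_≈_) renaming (sym to ≈-sym; trans to ≈-trans)

  points : HasCard (Points E) (∏ ⊤ e)
  points = HasCard-Points enum

  B? : Decidable B
  B? = Restrict-finite⇒dec (HasCard⇒≈? points) B-resp ∣B∣≡k

  ^ₛ-resp : ∀ g → (B ^ₛ g) Respects _≈_
  ^ₛ-resp g p≈q (r , r∈B , rg≈p) = r , r∈B , ≈-trans rg≈p p≈q

  -- A point lies in `B ^ₛ g` exactly when its image under the inverse of `g` lies in `B`.
  ^ₛ? : ∀ g → Decidable (B ^ₛ g)
  ^ₛ? g q = map′ (λ r∈B → from q , r∈B , strictlyInverseˡ q)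
    (λ (r , r∈B , rg≈q) → B-resp (≈-sym (inverseʳ (≈-sym rg≈q))) r∈B) (B? (from q))
    where open Inverse (action g)

  B^ε≐B : (B ^ₛ ε) ≐ B
  B^ε≐B = (λ (r , r∈B , r≈q) → B-resp r≈q r∈B) , λ {q} q∈B → q , q∈B , λ _ → refl

  C-resp : ∀ J β → C⟨ J ⟩ β Respects _≈_
  C-resp J β p≈q p∈C i i∈J = trans (sym (p≈q i)) (p∈C i i∈J)

  Class? : ∀ J δ → Decidable (Class {E = E} J δ)
  Class? J δ = Restrict-finite⇒dec (HasCard⇒≈? points)
    (λ p≈q p∈C i i∈J → trans (sym (p≈q i)) (p∈C i i∈J)) (HasSize-Class enum J δ)

  C? : ∀ J β → Decidable (C⟨ J ⟩ β)
  C? J β = Class? J (λ i _ → β i)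

  -- The constant λ governs pairs of distinct points only, so the count runs over the points other
  -- than the fixed `α`.
  Others : Setoid 0ℓ 0ℓ
  Others = Restrict (Points E) (λ p → ¬ α ≈ p)

  w : ℕ
  w = proj₁ (HasCard-remove points α)

  others : HasCard Others w
  others = proj₂ (proj₂ (HasCard-remove points α))

  -- y_J − 1, since α itself is left out of the count.
  y-1 : Subset s → ℕ
  y-1 J = count others (λ (p , _) → B? p ×-dec C? J α p)

  B∩C-resp : ∀ J → (B ∩ C⟨ J ⟩ α) Respects _≈_
  B∩C-resp J p≈q (p∈B , p∈C) = B-resp p≈q p∈B , C-resp J α p≈q p∈C

  HasSize⇒≡1+y-1 : ∀ J {n} → HasSize (B ∩ C⟨ J ⟩ α) n → n ≡ suc (y-1 J)
  HasSize⇒≡1+y-1 J = HasCard-Restrict-remove points (λ p → B? p ×-dec C? J α p) (B∩C-resp J)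
    α (α∈B , λ _ _ → refl) others

  -- Flag-transitivity gives `x` taking the flag (α, B) to (β, B^g). Acting coordinatewise, `x` maps
  -- the `J`-class of `α` onto that of `β`, so the two intersections have the same size.
  flag-size : ∀ J g β {n} → (B ^ₛ g) β → HasSize (B ^ₛ g ∩ C⟨ J ⟩ β) n → n ≡ suc (y-1 J)
  flag-size J g β β∈B^g size
    with x , αx≈β , B^εx⊆B^g , B^g⊆B^εx
      ← flag-transitive α ε (proj₂ B^ε≐B α∈B) β g β∈B^g
    = HasSize⇒≡1+y-1 J (HasCard-cong (Symmetry.inverse (Restrict-cong (action x)
        (λ p (p∈B , p∈C) →
          B^εx⊆B^g (p , proj₂ B^ε≐B p∈B , λ _ → refl) ,
          λ i i∈J → trans (cong (Inverse.to (x i)) (p∈C i i∈J)) (αx≈β i))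
        (λ q (q∈B^g , q∈C) →
          (let (r , r∈B^ε , rx≈q) = B^g⊆B^εx q∈B^g in
            B-resp (≈-sym (inverseʳ (≈-sym rx≈q))) (proj₁ B^ε≐B r∈B^ε)) ,
          λ i i∈J → trans (cong (Inverse.from (x i)) (trans (q∈C i i∈J) (sym (αx≈β i))))
            (strictlyInverseʳ α i))))
        size)
    where open Inverse (action x)

  -- Either `P` is empty, or some member `β` exhibits it as the trace of a block through `β` on the
  -- class of `β`, and `flag-size` applies.
  sizeIn : ∀ J {P : Pred (Point E) 0ℓ} → Decidable P → P Respects _≈_ →
    (∀ β → P β → ∃[ g ] (B ^ₛ g) β × P ≐ (B ^ₛ g ∩ C⟨ J ⟩ β)) →
    ∃[ n ] HasSize P n × (n ≡ 0 ⊎ n ≡ suc (y-1 J))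
  sizeIn J {P} P? P-resp locally = count points P? , size , 0-or-y
    where
    size : HasSize P (count points P?)
    size = HasCard-Restrict points P? P-resp
    0-or-y : count points P? ≡ 0 ⊎ count points P? ≡ suc (y-1 J)
    0-or-y with count points P? in eq
    ... | zero  = inj₁ refl
    ... | suc _ with β , Pβ ← count≡suc⇒∃ points P? eq
                with g , β∈B^g , P≐ ← locally β Pβ
                = inj₂ (trans (sym eq) (flag-size J g β β∈B^g (HasSize-≐ P≐ size)))

  block∩Class-size : ∀ J δ g →
    ∃[ n ] HasSize (B ^ₛ g ∩ Class J δ) n × (n ≡ 0 ⊎ n ≡ suc (y-1 J))
  block∩Class-size J δ g = sizeIn J
    (λ p → ^ₛ? g p ×-dec Class? J δ p)
    (λ p≈q (p∈B^g , p∈C) → ^ₛ-resp g p≈q p∈B^g , λ i i∈J → trans (sym (p≈q i)) (p∈C i i∈J))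
    -- A class is determined by any of its members, so the coordinates of `β` may replace `δ`.
    (λ β (β∈B^g , β∈C) → g , β∈B^g ,
      (λ (p∈B^g , p∈C) → p∈B^g , λ i i∈J → trans (p∈C i i∈J) (sym (β∈C i i∈J))) ,
      (λ (p∈B^g , p∈C) → p∈B^g , λ i i∈J → trans (p∈C i i∈J) (β∈C i i∈J)))

  -- The `j`-th coordinate splits the part of `B` in the `J - j` class of `α` into fibres. A
  -- nonempty fibre is the trace of `B` on a `J`-class, hence has size y_J.
  y∣y-remove : ∀ J {j} → j ∈ J → suc (y-1 J) ∣ suc (y-1 (J - j))
  y∣y-remove J {j} j∈J = subst (suc (y-1 J) ∣_)
    (HasSize⇒≡1+y-1 (J - j) (HasCard-Restrict points P? (B∩C-resp (J - j))))
    (∣-count-fibres points P? f fibre)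
    where
    P? : Decidable (B ∩ C⟨ J - j ⟩ α)
    P? p = B? p ×-dec C? (J - j) α p
    f : Point E → Fin (e j)
    f p = Inverse.to (enum j) (p j)
    f-injective : ∀ p q → f p ≡ f q → p j ≡ q j
    f-injective p q eq = trans (sym (Inverse.strictlyInverseʳ (enum j) (p j)))
      (Inverse.inverseʳ (enum j) eq)
    Fibre : Fin (e j) → Pred (Point E) 0ℓ
    Fibre b p = (B ∩ C⟨ J - j ⟩ α) p × f p ≡ b
    Fibre-resp : ∀ b → Fibre b Respects _≈_
    Fibre-resp b p≈q (p∈ , fp≡b) = B∩C-resp (J - j) p≈q p∈ ,
      trans (cong (Inverse.to (enum j)) (sym (p≈q j))) fp≡b
    Fibre≐ : ∀ b β → Fibre b β → ∃[ g ] (B ^ₛ g) β × Fibre b ≐ (B ^ₛ g ∩ C⟨ J ⟩ β)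
    Fibre≐ b β ((β∈B , β∈C) , fβ≡b) = ε , proj₂ B^ε≐B β∈B ,
      (λ {p} ((p∈B , p∈C) , fp≡b) → proj₂ B^ε≐B p∈B , λ i i∈J → agree p p∈C fp≡b i i∈J (i ≟ᶠ j)) ,
      (λ {p} (p∈B^ε , p∈C) →
        (proj₁ B^ε≐B p∈B^ε ,
          λ i i∈J-j → trans (p∈C i (p─q⊆p J ⁅ j ⁆ i∈J-j)) (β∈C i i∈J-j)) ,
        trans (cong (Inverse.to (enum j)) (p∈C j j∈J)) fβ≡b)
      where
      -- At `j` equality comes from the fibre; at the other indices in `J` both points agree with
      -- `α`.
      agree : ∀ p → C⟨ J - j ⟩ α p → f p ≡ b → ∀ i → i ∈ J → Dec (i ≡ j) → p i ≡ β i
      agree p p∈C fp≡b i i∈J (yes refl) = f-injective p β (trans fp≡b (sym fβ≡b))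
      agree p p∈C fp≡b i i∈J (no i≢j)   =
        let i∈J-j = x∈p∧x≢y⇒x∈p-y i∈J i≢j in trans (p∈C i i∈J-j) (sym (β∈C i i∈J-j))
    fibre : ∀ b → suc (y-1 J) ∣ count points (λ p → P? p ×-dec (f p ≟ᶠ b))
    fibre b with n , size , n∈ ← sizeIn J (λ p → P? p ×-dec (f p ≟ᶠ b)) (Fibre-resp b) (Fibre≐ b) =
      subst (suc (y-1 J) ∣_)
        (HasCard-unique size (HasCard-Restrict points (λ p → P? p ×-dec (f p ≟ᶠ b)) (Fibre-resp b)))
        (∣n n∈)
      where
      ∣n : ∀ {n} → n ≡ 0 ⊎ n ≡ suc (y-1 J) → suc (y-1 J) ∣ n
      ∣n (inj₁ refl) = _ ∣0
      ∣n (inj₂ refl) = ∣-refl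

  -- Double count over the blocks through `α`

  λ′ : ℕ
  λ′ = proj₁ design

  c-1 : Subset s → ℕ
  c-1 J = count others (C? J α ∘ proj₁)

  class-size : ∀ J → ∏ (∁ J) e ≡ suc (c-1 J)
  class-size J = HasCard-Restrict-remove points (C? J α) (C-resp J α) α (λ _ _ → refl) others
    (HasSize-Class enum J (λ i _ → α i))

  pt : Fin w → Point E
  pt = proj₁ ∘ Inverse.from others

  blocks : ∀ β → HasCard (BlocksThrough B α (pt β)) λ′
  blocks β = proj₂ design α (pt β) (proj₂ (Inverse.from others β))

  -- A group element for the `j`-th block through `α` and `pt β`. The numbering depends on `β`, so
  -- only sums over `j` can be compared for different `β`.
  block : Fin w → Fin λ′ → Group E
  block β j = proj₁ (Inverse.from (blocks β) j)

  incidence : Fin w → Fin λ′ → Fin w → ℕ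
  incidence β j γ = ⟦ ^ₛ? (block β j) (pt γ) ⟧

  -- Both sums count the blocks containing `α`, `pt β` and `pt γ`.
  incidence-sym : ∀ β γ →
    ∑[ j < λ′ ] incidence β j γ ≡ ∑[ j < λ′ ] incidence γ j β
  incidence-sym β γ = HasCard-unique (through β γ)
    (HasCard-cong (BlocksThrough-swap B α (pt γ) (pt β)) (through γ β))
    where
    through : ∀ β γ →
      HasCard (Restrict (BlocksThrough B α (pt β)) (λ (g , _) → (B ^ₛ g) (pt γ)))
        (∑[ j < λ′ ] incidence β j γ)
    through β γ = HasCard-Restrict (blocks β) (λ (g , _) → ^ₛ? g (pt γ)) (λ b≐b′ → proj₁ b≐b′)

  -- Each such block contains `α`, so `flag-size` applies to the flag at `α`. The sum leaves out `α`
  -- itself, hence `y-1 J` and not y_J.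
  block∩C-count : ∀ J β j →
    ∑[ γ < w ] (⟦ C? J α (pt γ) ⟧ * incidence β j γ) ≡ y-1 J
  block∩C-count J β j = suc-injective (begin
    suc (∑[ γ < w ] (⟦ C? J α (pt γ) ⟧ * incidence β j γ))
      ≡⟨ cong suc (sum-cong-≗ (λ γ → trans (*-comm ⟦ C? J α (pt γ) ⟧ _)
           (sym (⟦⟧-×-dec (^ₛ? g (pt γ)) (C? J α (pt γ)))))) ⟩
    suc (count others (P? ∘ proj₁))
      ≡⟨ HasCard-Restrict-remove points P? P-resp α (α∈B^g , λ _ _ → refl) others size ⟨
    count points P?
      ≡⟨ flag-size J g α α∈B^g size ⟩
    suc (y-1 J) ∎)
    where
    open ≡-Reasoning
    g : Group E
    g = block β j
    α∈B^g : (B ^ₛ g) α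
    α∈B^g = proj₁ (proj₂ (Inverse.from (blocks β) j))
    P? : Decidable (B ^ₛ g ∩ C⟨ J ⟩ α)
    P? p = ^ₛ? g p ×-dec C? J α p
    P-resp : (B ^ₛ g ∩ C⟨ J ⟩ α) Respects _≈_
    P-resp p≈q (p∈B^g , p∈C) = ^ₛ-resp g p≈q p∈B^g , C-resp J α p≈q p∈C
    size : HasSize (B ^ₛ g ∩ C⟨ J ⟩ α) (count points P?)
    size = HasCard-Restrict points P? P-resp

  -- If y_J exceeded 1, `B` would contain a point other than `α` and so be a block through two
  -- distinct points, against λ = 0.
  λ′≡0⇒y-1≡0 : λ′ ≡ 0 → ∀ J → y-1 J ≡ 0
  λ′≡0⇒y-1≡0 λ′≡0 J with y-1 J in eq
  ... | zero = refl
  ... | suc _ with (β , α≉β) , β∈B , _ ← count≡suc⇒∃ others (λ (p , _) → B? p ×-dec C? J α p) eq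
    = ⊥-elim (¬Fin0 (subst Fin λ′≡0 (Inverse.to (proj₂ design α β α≉β)
        (ε , proj₂ B^ε≐B α∈B , proj₂ B^ε≐B β∈B))))

  -- The double count weighted by the indicators of the `J`-class and the `K`-class of `α`, with λ
  -- cancelled. For λ = 0 both sides vanish.
  proportional : ∀ J K → c-1 K * y-1 J ≡ c-1 J * y-1 K
  proportional J K = cancel λ′ refl
    where
    counted : c-1 K * (λ′ * y-1 J) ≡ c-1 J * (λ′ * y-1 K)
    counted = double-count incidence incidence-sym
      (λ γ → ⟦ C? J α (pt γ) ⟧) (λ γ → ⟦ C? K α (pt γ) ⟧) (y-1 J) (y-1 K)
      (block∩C-count J) (block∩C-count K)
    vanish : λ′ ≡ 0 → ∀ J K → c-1 J * y-1 K ≡ 0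
    vanish λ′≡0 J K = trans (cong (c-1 J *_) (λ′≡0⇒y-1≡0 λ′≡0 K)) (*-zeroʳ (c-1 J))
    cancel : ∀ l → λ′ ≡ l → c-1 K * y-1 J ≡ c-1 J * y-1 K
    cancel zero    eq = trans (vanish eq K J) (sym (vanish eq J K))
    cancel (suc l) eq = *-cancelˡ-common l (c-1 K) (y-1 J) (c-1 J) (y-1 K)
      (subst (λ l → c-1 K * (l * y-1 J) ≡ c-1 J * (l * y-1 K)) eq counted)

  -- The case `K = ⊥` of `proportional`: the only class is the whole point set, so `c-1 ⊥` is v - 1
  -- and `y-1 ⊥` is k - 1.
  y-1-equation : ∀ J → y-1 J * (∏ ⊤ e ∸ 1) ≡ (∏ (∁ J) e ∸ 1) * (k ∸ 1)
  y-1-equation J = begin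
    y-1 J * (∏ ⊤ e ∸ 1)                               ≡⟨ *-comm (y-1 J) _ ⟩
    (∏ ⊤ e ∸ 1) * y-1 J                               ≡⟨ cong (λ K → (∏ K e ∸ 1) * y-1 J) ∁⊥≡⊤ ⟨
    (∏ (∁ ⊥) e ∸ 1) * y-1 J                           ≡⟨ cong (λ c → (c ∸ 1) * y-1 J) (class-size ⊥) ⟩
    c-1 ⊥ * y-1 J                                     ≡⟨ proportional J ⊥ ⟩
    c-1 J * y-1 ⊥                                     ≡⟨ cong₂ (λ c k → (c ∸ 1) * (k ∸ 1)) (class-size J) k≡ ⟨
    (∏ (∁ J) e ∸ 1) * (k ∸ 1)                         ∎
    where
    open ≡-Reasoning
    k≡ : k ≡ suc (y-1 ⊥)
    k≡ = HasSize⇒≡1+y-1 ⊥ (HasSize-≐ ((λ p∈B → p∈B , λ i i∈⊥ → ⊥-elim (∉⊥ i∈⊥)) , proj₁) ∣B∣≡k)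

  k>0 : 0 < k
  k>0 = ≤-<-trans z≤n (toℕ<n (Inverse.to ∣B∣≡k (α , α∈B)))

proposition6p2 :
    (s : ℕ) (2≤s : 2 ≤ s)
    (E : Fin s → Set) (e : Fin s → ℕ)
    (enum : ∀ i → E i ↔ Fin (e i)) (1<e : ∀ i → 1 < e i)
    (B : Pred (Point E) 0ℓ) (B-resp : B Respects (Setoid._≈_ (Points E)))
    (k : ℕ) (∣B∣≡k : HasSize B k) (B-nonempty : Satisfiable B) →
    let instance
          v-1≢0 : NonZero (∏ ⊤ e ∸ 1)
          v-1≢0 = v-1-nonZero 2≤s e 1<e
          D≢0 : NonZero (gcd[e-1] ⊤ e)
          D≢0 = D-nonZero 2≤s e 1<e
        v : ℕ
        v = ∏ ⊤ e
        D : ℕ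
        D = gcd[e-1] ⊤ e
        y : Subset s → ℚ
        y = arrayEntry e k
    in
    Is2Design B → FlagTransitive B →
    ((v ∸ 1) ∣ (k ∸ 1) * D × HasUniformArray B y) ×
    (∀ J → Nonempty J →
      ∃[ n ] 0 < n × y J ≡ ℕ→ℚ n × n ∣ (gcd[e-1] J e / D) * ∏ (∁ J) e) ×
    (∀ J (δ : E⟨ J ⟩) g → SizeIn⟨0, y J ⟩ (B ^ₛ g ∩ Class J δ))
proposition6p2 s 2≤s E e enum 1<e B B-resp k ∣B∣≡k (α , α∈B) design flag-transitive =
  (v-1∣[k-1]D ,
    (λ J → suc (y-1 J) , s≤s z≤n , arrayEntry≡1+y-1 J) , arrayEntry-⊤ , λ J _ → B-sizeIn J) ,
  (λ J _ → suc (y-1 J) , s≤s z≤n , arrayEntry≡1+y-1 J , y∣D_J/D*∏ J) ,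
  block-sizeIn
  where
  instance
    v-1≢0 : NonZero (∏ ⊤ e ∸ 1)
    v-1≢0 = v-1-nonZero 2≤s e 1<e
    D≢0 : NonZero (gcd[e-1] ⊤ e)
    D≢0 = D-nonZero 2≤s e 1<e
  open FlagTransitiveDesign enum B-resp ∣B∣≡k α∈B design flag-transitive
  open ArrayArithmetic 1<e k>0 y-1 y-1-equation y∣y-remove

  block-sizeIn : ∀ J (δ : E⟨ J ⟩) g → SizeIn⟨0, arrayEntry e k J ⟩ (B ^ₛ g ∩ Class J δ)
  block-sizeIn J δ g with n , size , n∈ ← block∩Class-size J δ g =
    n , size , Sum.map₂ (λ n≡ → trans (cong ℕ→ℚ n≡) (sym (arrayEntry≡1+y-1 J))) n∈

  B-sizeIn : ∀ J (δ : E⟨ J ⟩) → SizeIn⟨0, arrayEntry e k J ⟩ (B ∩ Class J δ)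
  -- The block given by the identity `ε` is `B` itself.
  B-sizeIn J δ with n , size , n∈ ← block-sizeIn J δ ε = n ,
    HasSize-≐ ((λ (p∈B^ε , p∈C) → proj₁ B^ε≐B p∈B^ε , p∈C) ,
      (λ (p∈B , p∈C) → proj₂ B^ε≐B p∈B , p∈C)) size , n∈
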